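{- There exists an absolute constant $C>0$ such that the following holds. Let $m,\ell$ be positive integers and let $N\ge C\ell m$. Let $G$ be a graph with $m$ edges and no isolated vertices, and let $f:\binom{[N]}{2}\to\binom{[N]}{\ell}$ be a function such that $f(e)\cap e=\emptyset$ for every $e\in\binom{[N]}{2}$. Then there exists an injective map $\varphi:V(G)\to[N]$ such that $f(\{\varphi(v),\varphi(u)\})\cap\varphi(V(G))=\emptyset$ for every edge $vu\in E(G)$.
   Context: $[N]=\{1,\dots,N\}$ and $\binom{[N]}{k}$ denotes the family of $k$-element subsets of $[N]$. -}

module Defs where

open import Data.Nat using (ℕ)
open import Data.Fin using (Fin)
open import Data.Fin.Subset using (Subset; _∈_; _∉_; ∣_∣)
open import Data.Product using (_×_; _,_; proj₁; proj₂; ∃)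
open import Data.Sum using (_⊎_)
open import Relation.Binary.PropositionalEquality using (_≡_; _≢_)
open import Relation.Nullary using (¬_)
open import Function.Definitions using (Injective)

-- A simple graph on vertex set Fin n with exactly m edges, given by an
-- enumeration of its edges: edge i = (u , v) stands for the edge {u,v}.
-- No loops, and distinct indices give distinct unordered pairs.
record Graph (n m : ℕ) : Set where
  field
    edge     : Fin m → Fin n × Fin n
    loopless : ∀ i → proj₁ (edge i) ≢ proj₂ (edge i)
    distinct : ∀ i j → i ≢ j →
               edge i ≢ edge j × edge i ≢ (proj₂ (edge j) , proj₁ (edge j))
open Graph public

NoIsolated : ∀ {n m} → Graph n m → Set
NoIsolated {n} {m} G =
  ∀ (v : Fin n) → ∃ λ (i : Fin m) → proj₁ (edge G i) ≡ v ⊎ proj₂ (edge G i) ≡ v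

-- A function f : ([N] choose 2) → ([N] choose ℓ) with f(e) ∩ e = ∅,
-- encoded as a symmetric function on ordered pairs (values on the
-- diagonal i = j are irrelevant).
record PairMap (N ℓ : ℕ) : Set where
  field
    fun     : Fin N → Fin N → Subset N
    sym     : ∀ i j → fun i j ≡ fun j i
    card    : ∀ i j → i ≢ j → ∣ fun i j ∣ ≡ ℓ
    avoidsˡ : ∀ i j → i ≢ j → i ∉ fun i j
    avoidsʳ : ∀ i j → i ≢ j → j ∉ fun i j
open PairMap public

Good : ∀ {n m N ℓ} → Graph n m → PairMap N ℓ → (Fin n → Fin N) → Set
Good {n} {m} G f φ =
  Injective _≡_ _≡_ φ ×
  (∀ (i : Fin m) (w : Fin n) →
     φ w ∉ fun f (φ (proj₁ (edge G i))) (φ (proj₂ (edge G i))))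

{-# OPTIONS --safe #-}

-- Place the vertices greedily in order of decreasing degree, so that the i-th vertex v
-- satisfies i · deg v ≤ 2m.  For points a, y let d(a,y) count the x with y ∈ f({a,x}).  When
-- v is placed at x, the sets f({φ(u),x}) of its placed neighbours u must miss the
-- placed points; the number of x violating this is at most the sum over these u of the load
-- R(u) = Σ_w d(φ(u),φ(w)), w ranging over the placed vertices.  Hence it suffices to keep
-- every load below s·i with s = 128ℓ.  On average a new point adds at most ℓ to a load, but
-- all loads have to stay below s·i simultaneously; this is ensured by a moving barrier: the
-- potential Σ_u 1/(s(i+1) - R(u)) is kept at most 3/s.  Loads that come close to the barrier
-- are then few enough that the points x overshooting it are rare, and the advance of the
-- barrier by s in each step pays for the growth of the potential.  In total there are seven
-- requirements on x, and by Markov's inequality each of them fails for at most N/8 points.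

module Submission where

open import Defs renaming (sym to fun-sym)
open import Level using (0ℓ)
open import Data.Bool using (Bool; true; false; if_then_else_)
open import Data.Nat using (ℕ; zero; suc; _+_; _*_; _∸_; _≤_; _<_; _>_; _!; _/_; _≤?_; z≤n; s≤s; s≤s⁻¹; >-nonZero; >-nonZero⁻¹)
open import Data.Nat.Properties hiding (_≟_)
open import Data.Nat.Divisibility using (∣-trans; m∣m*n; m≤n⇒m!∣n!)
open import Data.Nat.DivMod using (m*[n/m]≡n)
open import Data.Nat.Tactic.RingSolver using (solve-∀)
open import Data.Fin using (Fin; suc; fromℕ<; _≟_)
open import Data.Fin.Subset using (Subset; _∉_; ∣_∣)
open import Data.Vec using ([]; _∷_; lookup)
open import Data.Vec.Properties using ([]=⇒lookup; lookup⇒[]=)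
open import Data.Vec.Functional using (updateAt)
open import Data.Vec.Functional.Properties using (updateAt-updates; updateAt-minimal)
open import Data.List using (List; []; _∷_; length; map; allFin; tabulate)
open import Data.List.Properties using (length-map; length-tabulate; map-tabulate; map-cong-local)
open import Data.List.Membership.Propositional using (_∈_)
open import Data.List.Membership.Propositional.Properties using (∈-allFin; ∈-map⁺)
open import Data.List.Relation.Binary.Permutation.Propositional using (↭-sym; ↭⇒↭ₛ)
open import Data.List.Relation.Binary.Permutation.Propositional.Properties using (∈-resp-↭)
open import Data.List.Relation.Binary.Permutation.Setoid.Properties using (Unique-resp-↭)
open import Data.List.Relation.Unary.All as All using (All)
open import Data.List.Relation.Unary.AllPairs using (AllPairs; []; _∷_)
open import Data.List.Relation.Unary.Any using (here; there)
open import Data.List.Relation.Unary.Sorted.TotalOrder.Properties using (Sorted⇒AllPairs)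
open import Data.List.Relation.Unary.Unique.Propositional using (Unique)
open import Data.List.Relation.Unary.Unique.Propositional.Properties using (allFin⁺)
import Data.List.Sort
open import Data.Product using (Σ; ∃; ∃₂; _×_; _,_; proj₁; proj₂)
open import Data.Sum using (inj₁; inj₂)
open import Function using (_∘_; id)
open import Relation.Nullary using (yes; no; does; contradiction)
open import Relation.Binary.Bundles using (DecTotalOrder)
import Relation.Binary.Construct.On as On
open import Relation.Binary.PropositionalEquality using (_≡_; _≢_; refl; sym; trans; cong; cong₂; subst; subst₂; setoid)

-- Finite sums over lists.

private variable
  A A′ : Set

∑ : List A → (A → ℕ) → ℕ
∑ []       f = 0
∑ (x ∷ xs) f = f x + ∑ xs f

∑-mono : ∀ (xs : List A) {f g : A → ℕ} → (∀ {x} → x ∈ xs → f x ≤ g x) → ∑ xs f ≤ ∑ xs g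
∑-mono []       f≤g = z≤n
∑-mono (x ∷ xs) f≤g = +-mono-≤ (f≤g (here refl)) (∑-mono xs (f≤g ∘ there))

∑-cong : ∀ (xs : List A) {f g : A → ℕ} → (∀ x → f x ≡ g x) → ∑ xs f ≡ ∑ xs g
∑-cong []       f≡g = refl
∑-cong (x ∷ xs) f≡g = cong₂ _+_ (f≡g x) (∑-cong xs f≡g)

∑-+ : ∀ (xs : List A) (f g : A → ℕ) → ∑ xs (λ x → f x + g x) ≡ ∑ xs f + ∑ xs g
∑-+ []       f g = refl
∑-+ (x ∷ xs) f g rewrite ∑-+ xs f g = lemma (f x) (g x) (∑ xs f) (∑ xs g)
  where
  lemma : ∀ a b c d → a + b + (c + d) ≡ a + c + (b + d)
  lemma = solve-∀

∑-*ˡ : ∀ (xs : List A) c (f : A → ℕ) → ∑ xs (λ x → c * f x) ≡ c * ∑ xs f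
∑-*ˡ []       c f = sym (*-zeroʳ c)
∑-*ˡ (x ∷ xs) c f = trans (cong (c * f x +_) (∑-*ˡ xs c f)) (sym (*-distribˡ-+ c (f x) _))

∑-*ʳ : ∀ (xs : List A) c (f : A → ℕ) → ∑ xs (λ x → f x * c) ≡ ∑ xs f * c
∑-*ʳ xs c f = trans (∑-cong xs (λ x → *-comm (f x) c)) (trans (∑-*ˡ xs c f) (*-comm c _))

∑-const : ∀ (xs : List A) c → ∑ xs (λ _ → c) ≡ length xs * c
∑-const []       c = refl
∑-const (x ∷ xs) c = cong (c +_) (∑-const xs c)

∑-0 : ∀ (xs : List A) → ∑ xs (λ _ → 0) ≡ 0
∑-0 xs = trans (∑-const xs 0) (*-zeroʳ (length xs))

∑-bound : ∀ (xs : List A) {f : A → ℕ} {c} → (∀ {x} → x ∈ xs → f x ≤ c) → ∑ xs f ≤ length xs * c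
∑-bound xs f≤c = ≤-trans (∑-mono xs f≤c) (≤-reflexive (∑-const xs _))

∑-swap : ∀ (xs : List A) (ys : List A′) (f : A → A′ → ℕ) →
         ∑ xs (λ x → ∑ ys (f x)) ≡ ∑ ys (λ y → ∑ xs (λ x → f x y))
∑-swap []       ys f = sym (∑-0 ys)
∑-swap (x ∷ xs) ys f = trans (cong (∑ ys (f x) +_) (∑-swap xs ys f)) (sym (∑-+ ys (f x) _))

∑-∈ : ∀ {xs : List A} {x} (f : A → ℕ) → x ∈ xs → f x ≤ ∑ xs f
∑-∈ f (here refl) = m≤m+n _ _
∑-∈ f (there x∈)  = ≤-trans (∑-∈ f x∈) (m≤n+m _ _)

∑≡0⇒≡0 : ∀ {xs : List A} {x} (f : A → ℕ) → ∑ xs f ≡ 0 → x ∈ xs → f x ≡ 0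
∑≡0⇒≡0 f eq x∈ = n≤0⇒n≡0 (≤-trans (∑-∈ f x∈) (≤-reflexive eq))

∑-map : ∀ (g : A → A′) (xs : List A) (f : A′ → ℕ) → ∑ (map g xs) f ≡ ∑ xs (f ∘ g)
∑-map g []       f = refl
∑-map g (x ∷ xs) f = cong (f (g x) +_) (∑-map g xs f)

length-allFin : ∀ n → length (allFin n) ≡ n
length-allFin n = length-tabulate id

-- Counting exceptional points.

-- Q fails for at most k N / 8 points; the count may include points where Q holds, and
-- points with multiplicity.
record Mostly {N : ℕ} (k : ℕ) (Q : Fin N → Set) : Set where
  constructor mostly
  field
    exceptions : Fin N → ℕ
    rare       : 8 * ∑ (allFin N) exceptions ≤ k * N
    holds      : ∀ x → exceptions x ≡ 0 → Q x

module _ {N : ℕ} where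

  mostly-map : ∀ {k} {P Q : Fin N → Set} → (∀ {x} → P x → Q x) → Mostly k P → Mostly k Q
  mostly-map P⇒Q (mostly h small ok) = mostly h small λ x hx → P⇒Q (ok x hx)

  mostly-× : ∀ {j k} {P Q : Fin N → Set} → Mostly j P → Mostly k Q → Mostly (j + k) (λ x → P x × Q x)
  mostly-× {j} {k} (mostly g g-small g-ok) (mostly h h-small h-ok) =
    mostly (λ x → g x + h x) small λ x eq → g-ok x (m+n≡0⇒m≡0 (g x) eq) , h-ok x (m+n≡0⇒n≡0 (g x) eq)
    where
    open ≤-Reasoning
    small : 8 * ∑ (allFin N) (λ x → g x + h x) ≤ (j + k) * N
    small = begin
      8 * ∑ (allFin N) (λ x → g x + h x)         ≡⟨ cong (8 *_) (∑-+ (allFin N) g h) ⟩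
      8 * (∑ (allFin N) g + ∑ (allFin N) h)      ≡⟨ *-distribˡ-+ 8 (∑ (allFin N) g) _ ⟩
      8 * ∑ (allFin N) g + 8 * ∑ (allFin N) h    ≤⟨ +-mono-≤ g-small h-small ⟩
      j * N + k * N                              ≡⟨ sym (*-distribʳ-+ N j k) ⟩
      (j + k) * N                                ∎

  -- A union bound: `g` counts the reasons that forbid a point.
  mostly-zero : ∀ (g : Fin N → ℕ) → 8 * ∑ (allFin N) g ≤ N → Mostly 1 (λ x → g x ≡ 0)
  mostly-zero g small = mostly g (≤-trans small (≤-reflexive (sym (*-identityˡ N)))) λ _ eq → eq

  -- Markov's inequality. As the values are integers, a point with `g x > t` contributes at least
  -- `suc t`; dividing by `suc t` instead of `t` also covers `t = 0`, which occurs in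
  -- `mostly-square` when nothing is placed yet.
  markov : ∀ (g : Fin N → ℕ) t → 8 * ∑ (allFin N) g ≤ t * N → Mostly 1 (λ x → g x ≤ t)
  markov g t small = mostly h h-small h-ok
    where
    h : Fin N → ℕ
    h x with g x ≤? t
    ... | yes _ = 0
    ... | no  _ = 1

    h-ok : ∀ x → h x ≡ 0 → g x ≤ t
    h-ok x eq with g x ≤? t
    ... | yes p = p
    h-ok x () | no _

    h≤g : ∀ x → suc t * h x ≤ g x
    h≤g x with g x ≤? t
    ... | yes _ = ≤-trans (≤-reflexive (*-zeroʳ t)) z≤n
    ... | no ¬p = ≤-trans (≤-reflexive (*-identityʳ (suc t))) (≰⇒> ¬p)

    open ≤-Reasoning
    regroup : ∀ a b → suc a * (8 * b) ≡ 8 * (suc a * b)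
    regroup = solve-∀

    h-small : 8 * ∑ (allFin N) h ≤ 1 * N
    h-small = *-cancelˡ-≤ (suc t) (begin
      suc t * (8 * ∑ (allFin N) h)           ≡⟨ regroup t (∑ (allFin N) h) ⟩
      8 * (suc t * ∑ (allFin N) h)           ≡⟨ cong (8 *_) (∑-*ˡ (allFin N) (suc t) h) ⟨
      8 * ∑ (allFin N) (λ x → suc t * h x)   ≤⟨ *-monoʳ-≤ 8 (∑-mono (allFin N) (λ {x} _ → h≤g x)) ⟩
      8 * ∑ (allFin N) g                     ≤⟨ small ⟩
      t * N                                  ≤⟨ *-monoˡ-≤ N (n≤1+n t) ⟩
      suc t * N                              ≡⟨ cong (suc t *_) (*-identityˡ N) ⟨
      suc t * (1 * N)                        ∎)

∑<length⇒zero : ∀ (xs : List A) (h : A → ℕ) → ∑ xs h < length xs → ∃ λ x → h x ≡ 0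
∑<length⇒zero (x ∷ xs) h lt with h x in eq
... | zero  = x , eq
... | suc k = ∑<length⇒zero xs h (≤-trans (s≤s (m≤n+m _ k)) (s≤s⁻¹ lt))

-- The exceptions sum to at most 7N/8 < N, so one of the N points carries none.
mostly⇒∃ : ∀ {N} {Q : Fin N → Set} → N > 0 → Mostly 7 Q → ∃ Q
mostly⇒∃ {N} N>0 (mostly h small ok) = x , ok x hx
  where
  open ≤-Reasoning
  few : ∑ (allFin N) h < N
  few = *-cancelˡ-< 8 _ _ (begin-strict
    8 * ∑ (allFin N) h   ≤⟨ small ⟩
    7 * N                <⟨ m<n+m (7 * N) N>0 ⟩
    8 * N                ∎)
  zero-point : ∃ λ x → h x ≡ 0
  zero-point = ∑<length⇒zero (allFin N) h (<-≤-trans few (≤-reflexive (sym (length-allFin N))))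
  x = proj₁ zero-point
  hx = proj₂ zero-point

-- Inequalities for scaled reciprocals.

-- With the larger number written as the smaller one plus `z`, the two sides differ by `z * z`.
2xy≤x²+y² : ∀ x y → 2 * (x * y) ≤ x * x + y * y
2xy≤x²+y² x y with ≤-total x y
... | inj₁ x≤y = subst (λ y → 2 * (x * y) ≤ x * x + y * y) (m+[n∸m]≡n x≤y) (≤-trans (m≤m+n _ _) (≤-reflexive (expand x (y ∸ x))))
  where
  expand : ∀ x z → 2 * (x * (x + z)) + z * z ≡ x * x + (x + z) * (x + z)
  expand = solve-∀
... | inj₂ y≤x = subst (λ x → 2 * (x * y) ≤ x * x + y * y) (m+[n∸m]≡n y≤x) (≤-trans (m≤m+n _ _) (≤-reflexive (expand y (x ∸ y))))
  where
  expand : ∀ y z → 2 * ((y + z) * y) + z * z ≡ (y + z) * (y + z) + y * y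
  expand = solve-∀

-- q T plays the role of 1 / T, scaled by the common denominator B.
reciprocals : ∀ M → ∃₂ λ B (q : ℕ → ℕ) → B > 0 × (∀ T → T > 0 → T ≤ M → T * q T ≡ B)
-- `M !` is a common multiple of all T from 1 to M, so every quotient is exact.
reciprocals M = M ! , q , >-nonZero⁻¹ (M !) ⦃ M !≢0 ⦄ , T*q
  where
  q : ℕ → ℕ
  q zero    = 0
  q (suc t) = M ! / suc t
  T*q : ∀ T → T > 0 → T ≤ M → T * q T ≡ M !
  T*q (suc t) _ T≤M = m*[n/m]≡n (∣-trans (m∣m*n (t !)) (m≤n⇒m!∣n! T≤M))

reciprocal-≤ : ∀ {B T T′ q q′} → T > 0 → T * q ≡ B → T′ * q′ ≡ B → T ≤ 2 * T′ → q′ ≤ 2 * q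
reciprocal-≤ {B} {T} {T′} {q} {q′} T>0 Tq T′q′ T≤2T′ = *-cancelˡ-≤ T ⦃ >-nonZero T>0 ⦄ (begin
  T * q′           ≤⟨ *-monoˡ-≤ q′ T≤2T′ ⟩
  2 * T′ * q′      ≡⟨ *-assoc 2 T′ q′ ⟩
  2 * (T′ * q′)    ≡⟨ cong (2 *_) (trans T′q′ (sym Tq)) ⟩
  2 * (T * q)      ≡⟨ swap T q ⟩
  T * (2 * q)      ∎)
  where
  open ≤-Reasoning
  swap : ∀ a b → 2 * (a * b) ≡ a * (2 * b)
  swap = solve-∀

-- With R = s k - T, one has (k+1)/T′ - k/T = (k d - R)/(T T′).  Since T and T′ agree up
-- to a factor 2, this is at most 2 k d / T² - R / (2 T²), and the AM-GM inequality absorbs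
-- the part of R / T² that is not needed to offset an average d.
slack-step : ∀ {B s k T T′ R d q q′} → s > 0 →
  T * q ≡ B → T′ * q′ ≡ B → T′ + d ≡ T + s → R + T ≡ s * k → 2 * d ≤ T → s ≤ T →
  4 * (s * k * suc k * B) * q′ + s * k * (s * k) * (q * q)
    ≤ 4 * (s * k * k * B) * q + 8 * (s * k * k) * (d * (q * q)) + B * B
slack-step {B} {s} {k} {T} {T′} {R} {d} {q} {q′} s>0 Tq T′q′ shift R+T 2d≤T s≤T =
  -- Multiplying `second` by 2sk puts 2(sk)²q² on the left: one half pays for AM-GM applied to skq
  -- and B, the other half stays in the conclusion.
  +-cancelʳ-≤ (s * k * (s * k) * (q * q)) _ _ (begin
    4 * (s * k * suc k * B) * q′ + s * k * (s * k) * (q * q) + s * k * (s * k) * (q * q)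
      ≡⟨ expandˡ B s k q q′ ⟩
    2 * s * k * (2 * (suc k * q′ * B) + s * k * (q * q))
      ≤⟨ *-monoʳ-≤ (2 * s * k) second ⟩
    2 * s * k * (2 * (k * q * B) + 4 * (k * d * (q * q)) + B * q)
      ≡⟨ expandʳ B s k d q ⟩
    rest + 2 * (s * k * q * B)
      ≤⟨ +-monoʳ-≤ rest (2xy≤x²+y² (s * k * q) B) ⟩
    rest + (s * k * q * (s * k * q) + B * B)
      ≡⟨ rotate rest s k q (B * B) ⟩
    rest + B * B + s * k * (s * k) * (q * q) ∎)
  where
  open ≤-Reasoning
  rest : ℕ
  rest = 4 * (s * k * k * B) * q + 8 * (s * k * k) * (d * (q * q))

  expandˡ : ∀ B s k q q′ →
    4 * (s * k * suc k * B) * q′ + s * k * (s * k) * (q * q) + s * k * (s * k) * (q * q)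
      ≡ 2 * s * k * (2 * (suc k * q′ * B) + s * k * (q * q))
  expandˡ = solve-∀
  expandʳ : ∀ B s k d q →
    2 * s * k * (2 * (k * q * B) + 4 * (k * d * (q * q)) + B * q)
      ≡ 4 * (s * k * k * B) * q + 8 * (s * k * k) * (d * (q * q)) + 2 * (s * k * q * B)
  expandʳ = solve-∀
  rotate : ∀ a s k q c → a + (s * k * q * (s * k * q) + c) ≡ a + c + s * k * (s * k) * (q * q)
  rotate = solve-∀

  T>0 : T > 0
  T>0 = <-≤-trans s>0 s≤T

  -- `2 * d ≤ T` prevents the slack from falling below half, `s ≤ T` prevents it from more than
  -- doubling.
  T≤2T′ : T ≤ 2 * T′
  T≤2T′ = +-cancelʳ-≤ (2 * d) T (2 * T′) (begin
    T + 2 * d        ≤⟨ +-monoʳ-≤ T 2d≤T ⟩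
    T + T            ≤⟨ +-mono-≤ (m≤m+n T s) (m≤m+n T s) ⟩
    T + s + (T + s)  ≡⟨ cong₂ _+_ shift shift ⟨
    T′ + d + (T′ + d) ≡⟨ double T′ d ⟩
    2 * T′ + 2 * d   ∎)
    where
    double : ∀ a b → a + b + (a + b) ≡ 2 * a + 2 * b
    double = solve-∀

  T′≤2T : T′ ≤ 2 * T
  T′≤2T = begin
    T′      ≤⟨ m≤m+n T′ d ⟩
    T′ + d  ≡⟨ shift ⟩
    T + s   ≤⟨ +-monoʳ-≤ T s≤T ⟩
    T + T   ≡⟨ cong (T +_) (+-identityʳ T) ⟨
    2 * T   ∎

  T′>0 : T′ > 0
  T′>0 = *-cancelˡ-< 2 0 T′ (<-≤-trans T>0 T≤2T′)

  q′≤2q : q′ ≤ 2 * q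
  q′≤2q = reciprocal-≤ {T′ = T′} T>0 Tq T′q′ T≤2T′
  q≤2q′ : q ≤ 2 * q′
  q≤2q′ = reciprocal-≤ {T′ = T} T′>0 T′q′ Tq T′≤2T

  exact : suc k * q′ * B + R * (q * q′) ≡ k * q * B + k * d * (q * q′)
  exact = begin-equality
    suc k * q′ * B + R * (q * q′)           ≡⟨ cong (λ b → suc k * q′ * b + R * (q * q′)) Tq ⟨
    suc k * q′ * (T * q) + R * (q * q′)     ≡⟨ left k T R q q′ ⟩
    (k * T + (R + T)) * (q * q′)            ≡⟨ cong (λ z → (k * T + z) * (q * q′)) R+T ⟩
    (k * T + s * k) * (q * q′)              ≡⟨ middle k T s q q′ ⟩
    k * (T + s) * (q * q′)                  ≡⟨ cong (λ z → k * z * (q * q′)) shift ⟨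
    k * (T′ + d) * (q * q′)                 ≡⟨ right k T′ d q q′ ⟩
    k * q * (T′ * q′) + k * d * (q * q′)    ≡⟨ cong (λ b → k * q * b + k * d * (q * q′)) T′q′ ⟩
    k * q * B + k * d * (q * q′)            ∎
    where
    left : ∀ k T R q q′ → suc k * q′ * (T * q) + R * (q * q′) ≡ (k * T + (R + T)) * (q * q′)
    left = solve-∀
    middle : ∀ k T s q q′ → (k * T + s * k) * (q * q′) ≡ k * (T + s) * (q * q′)
    middle = solve-∀
    right : ∀ k T d q q′ → k * (T + d) * (q * q′) ≡ k * q * (T * q′) + k * d * (q * q′)
    right = solve-∀

  first : 2 * (suc k * q′ * B) + R * (q * q) ≤ 2 * (k * q * B) + 4 * (k * d * (q * q))
  first = begin
    2 * (suc k * q′ * B) + R * (q * q)            ≤⟨ +-monoʳ-≤ _ (*-monoʳ-≤ R (*-monoʳ-≤ q q≤2q′)) ⟩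
    2 * (suc k * q′ * B) + R * (q * (2 * q′))     ≡⟨ pull (suc k * q′ * B) R q q′ ⟩
    2 * (suc k * q′ * B + R * (q * q′))           ≡⟨ cong (2 *_) exact ⟩
    2 * (k * q * B + k * d * (q * q′))            ≤⟨ *-monoʳ-≤ 2 (+-monoʳ-≤ (k * q * B) (*-monoʳ-≤ (k * d) (*-monoʳ-≤ q q′≤2q))) ⟩
    2 * (k * q * B + k * d * (q * (2 * q)))       ≡⟨ push (k * q * B) (k * d) q ⟩
    2 * (k * q * B) + 4 * (k * d * (q * q))       ∎
    where
    pull : ∀ a R q q′ → 2 * a + R * (q * (2 * q′)) ≡ 2 * (a + R * (q * q′))
    pull = solve-∀
    push : ∀ a b q → 2 * (a + b * (q * (2 * q))) ≡ 2 * a + 4 * (b * (q * q))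
    push = solve-∀

  -- Adding T q² = B q to both sides of `first` replaces R by R + T = sk, which is the same for all
  -- points.
  second : 2 * (suc k * q′ * B) + s * k * (q * q) ≤ 2 * (k * q * B) + 4 * (k * d * (q * q)) + B * q
  second = begin
    2 * (suc k * q′ * B) + s * k * (q * q)               ≡⟨ cong (λ z → 2 * (suc k * q′ * B) + z * (q * q)) R+T ⟨
    2 * (suc k * q′ * B) + (R + T) * (q * q)             ≡⟨ split (2 * (suc k * q′ * B)) R T q ⟩
    2 * (suc k * q′ * B) + R * (q * q) + T * q * q       ≤⟨ +-mono-≤ first (≤-reflexive (cong (_* q) Tq)) ⟩
    2 * (k * q * B) + 4 * (k * d * (q * q)) + B * q      ∎
    where
    split : ∀ a R T q → a + (R + T) * (q * q) ≡ a + R * (q * q) + T * q * q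
    split = solve-∀

-- The moving barrier.

module Balance
  (N ℓ s L B : ℕ) (q : ℕ → ℕ)
  (ℓ>0 : ℓ > 0) (s≡128ℓ : s ≡ 128 * ℓ) (B>0 : B > 0)
  -- With at most `L` points placed, no slack exceeds `s * suc L`.
  (T*q : ∀ T → T > 0 → T ≤ s * suc L → T * q T ≡ B)
  (d : Fin N → Fin N → ℕ)
  (d-row : ∀ a → ∑ (allFin N) (d a) ≤ ℓ * N)
  (d-diag : ∀ a → d a a ≡ 0)
  where

  load : List (Fin N) → Fin N → ℕ
  load ps a = ∑ ps (d a)

  -- The barrier for i points stands at s(i+1), while the loads of placed points stay below s·i;
  -- their slack is thus at least s and the subtraction is not truncated.
  slack : List (Fin N) → Fin N → ℕ
  slack ps a = s * suc (length ps) ∸ load ps a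

  weight : List (Fin N) → Fin N → ℕ
  weight ps a = q (slack ps a)

  -- `column≤` controls the load that a new point brings with it. `potential≤` is cleared of
  -- denominators: the potential times the height of the barrier grows by at most 3 per placed
  -- point, in units of `B`.
  record Balanced (ps : List (Fin N)) : Set where
    field
      load≤      : ∀ {a} → a ∈ ps → load ps a ≤ s * length ps
      column≤    : ∀ {c} → c ∈ ps → ∑ (allFin N) (λ a → d a c) ≤ 8 * (ℓ * N)
      potential≤ : s * suc (length ps) * ∑ ps (weight ps) ≤ 3 * length ps * B

  open Balanced public

  balanced-[] : Balanced []
  balanced-[] = record
    { load≤      = λ ()
    ; column≤    = λ ()
    ; potential≤ = ≤-reflexive (*-zeroʳ (s * 1))
    }

  s>0 : s > 0
  s>0 = subst (_> 0) (sym s≡128ℓ) (<-≤-trans ℓ>0 (m≤m+n ℓ (127 * ℓ)))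

  module Extend {ps : List (Fin N)} (bal : Balanced ps) (short : length ps < L) where

    open ≤-Reasoning

    i k : ℕ
    i = length ps
    k = suc i

    w : Fin N → ℕ
    w = weight ps

    W Q : ℕ
    W = ∑ ps w
    Q = ∑ ps (λ a → w a * w a)

    load+slack : ∀ {a} → a ∈ ps → load ps a + slack ps a ≡ s * k
    load+slack a∈ = m+[n∸m]≡n (≤-trans (load≤ bal a∈) (*-monoʳ-≤ s (n≤1+n i)))

    s≤slack : ∀ {a} → a ∈ ps → s ≤ slack ps a
    s≤slack {a} a∈ = +-cancelˡ-≤ (load ps a) _ _ (begin
      load ps a + s            ≤⟨ +-monoˡ-≤ s (load≤ bal a∈) ⟩
      s * i + s                ≡⟨ +-comm (s * i) s ⟩
      s + s * i                ≡⟨ *-suc s i ⟨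
      s * k                    ≡⟨ load+slack a∈ ⟨
      load ps a + slack ps a   ∎)

    slack*w : ∀ {a} → a ∈ ps → slack ps a * w a ≡ B
    slack*w {a} a∈ = T*q _ (<-≤-trans s>0 (s≤slack a∈))
      (≤-trans (m∸n≤m _ (load ps a)) (*-monoʳ-≤ s (≤-trans short (n≤1+n L))))

    -- Makes the average over x of Σ d(a,x)/slack(a) at most 1/16, so that Markov's inequality can
    -- be applied at the threshold 1/2.
    16ℓW≤B : 16 * ℓ * W ≤ B
    16ℓW≤B = *-cancelˡ-≤ (8 * k) (begin
      8 * k * (16 * ℓ * W)   ≡⟨ regroup k ℓ W ⟩
      128 * ℓ * k * W        ≡⟨ cong (λ z → z * k * W) s≡128ℓ ⟨
      s * k * W              ≤⟨ potential≤ bal ⟩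
      3 * i * B              ≤⟨ *-monoˡ-≤ B (*-mono-≤ {3} {8} (s≤s (s≤s (s≤s z≤n))) (n≤1+n i)) ⟩
      8 * k * B              ∎)
      where
      regroup : ∀ k ℓ W → 8 * k * (16 * ℓ * W) ≡ 128 * ℓ * k * W
      regroup = solve-∀

    ∑-rows : ∀ (c : Fin N → ℕ) → ∑ (allFin N) (λ x → ∑ ps (λ a → d a x * c a)) ≤ ∑ ps c * (ℓ * N)
    ∑-rows c = begin
      ∑ (allFin N) (λ x → ∑ ps (λ a → d a x * c a))   ≡⟨ ∑-swap (allFin N) ps _ ⟩
      ∑ ps (λ a → ∑ (allFin N) (λ x → d a x * c a))   ≤⟨ ∑-mono ps (λ {a} _ → row a) ⟩
      ∑ ps (λ a → c a * (ℓ * N))                      ≡⟨ ∑-*ʳ ps (ℓ * N) c ⟩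
      ∑ ps c * (ℓ * N)                                ∎
      where
      row : ∀ a → ∑ (allFin N) (λ x → d a x * c a) ≤ c a * (ℓ * N)
      row a = begin
        ∑ (allFin N) (λ x → d a x * c a)   ≡⟨ ∑-*ʳ (allFin N) (c a) (d a) ⟩
        ∑ (allFin N) (d a) * c a           ≤⟨ *-monoˡ-≤ (c a) (d-row a) ⟩
        ℓ * N * c a                        ≡⟨ *-comm (ℓ * N) (c a) ⟩
        c a * (ℓ * N)                      ∎

    -- `Column` preserves `column≤`. `Load` keeps the new point itself far from the barrier, and
    -- `Weight` keeps the old points from crossing it. `Square` controls the error term of
    -- `slack-step` after summation.
    Column Load Weight Square : Fin N → Set
    Column x = ∑ (allFin N) (λ a → d a x) ≤ 8 * (ℓ * N)
    Load x   = 2 * load ps x ≤ s * k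
    Weight x = 2 * ∑ ps (λ a → d a x * w a) ≤ B
    Square x = ∑ ps (λ a → d a x * (w a * w a)) ≤ 8 * ℓ * Q

    mostly-column : Mostly 1 Column
    mostly-column = markov _ _ (begin
      8 * ∑ (allFin N) (λ x → ∑ (allFin N) (λ a → d a x))   ≡⟨ cong (8 *_) (∑-swap (allFin N) (allFin N) _) ⟩
      8 * ∑ (allFin N) (λ a → ∑ (allFin N) (d a))           ≤⟨ *-monoʳ-≤ 8 (∑-bound (allFin N) (λ {a} _ → d-row a)) ⟩
      8 * (length (allFin N) * (ℓ * N))                     ≡⟨ cong (λ z → 8 * (z * (ℓ * N))) (length-allFin N) ⟩
      8 * (N * (ℓ * N))                                     ≡⟨ regroup N (ℓ * N) ⟩
      8 * (ℓ * N) * N                                       ∎)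
      where
      regroup : ∀ a b → 8 * (a * b) ≡ 8 * b * a
      regroup = solve-∀

    -- Summing over x gives the columns of the placed points, which `column≤` bounds. The 128 in s
    -- is 8 · 2 · 8: from Markov, from the factor in `Load` and from the column bound.
    mostly-load : Mostly 1 Load
    mostly-load = markov _ _ (begin
      8 * ∑ (allFin N) (λ x → 2 * load ps x)                  ≡⟨ cong (8 *_) (∑-*ˡ (allFin N) 2 (load ps)) ⟩
      8 * (2 * ∑ (allFin N) (load ps))                        ≡⟨ cong (λ z → 8 * (2 * z)) (∑-swap (allFin N) ps d) ⟩
      8 * (2 * ∑ ps (λ c → ∑ (allFin N) (λ x → d x c)))       ≤⟨ *-monoʳ-≤ 8 (*-monoʳ-≤ 2 (∑-bound ps (column≤ bal))) ⟩
      8 * (2 * (i * (8 * (ℓ * N))))                           ≡⟨ regroup i ℓ N ⟩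
      128 * ℓ * i * N                                         ≡⟨ cong (λ z → z * i * N) s≡128ℓ ⟨
      s * i * N                                               ≤⟨ *-monoˡ-≤ N (*-monoʳ-≤ s (n≤1+n i)) ⟩
      s * k * N                                               ∎)
      where
      regroup : ∀ i ℓ N → 8 * (2 * (i * (8 * (ℓ * N)))) ≡ 128 * ℓ * i * N
      regroup = solve-∀

    mostly-weight : Mostly 1 Weight
    mostly-weight = markov _ _ (begin
      8 * ∑ (allFin N) (λ x → 2 * ∑ ps (λ a → d a x * w a))     ≡⟨ cong (8 *_) (∑-*ˡ (allFin N) 2 _) ⟩
      8 * (2 * ∑ (allFin N) (λ x → ∑ ps (λ a → d a x * w a)))   ≤⟨ *-monoʳ-≤ 8 (*-monoʳ-≤ 2 (∑-rows w)) ⟩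
      8 * (2 * (W * (ℓ * N)))                                   ≡⟨ regroup W ℓ N ⟩
      16 * ℓ * W * N                                            ≤⟨ *-monoˡ-≤ N 16ℓW≤B ⟩
      B * N                                                     ∎)
      where
      regroup : ∀ W ℓ N → 8 * (2 * (W * (ℓ * N))) ≡ 16 * ℓ * W * N
      regroup = solve-∀

    mostly-square : Mostly 1 Square
    mostly-square = markov _ _ (begin
      8 * ∑ (allFin N) (λ x → ∑ ps (λ a → d a x * (w a * w a)))   ≤⟨ *-monoʳ-≤ 8 (∑-rows (λ a → w a * w a)) ⟩
      8 * (Q * (ℓ * N))                                           ≡⟨ regroup Q ℓ N ⟩
      8 * ℓ * Q * N                                               ∎)
      where
      regroup : ∀ Q ℓ N → 8 * (Q * (ℓ * N)) ≡ 8 * ℓ * Q * N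
      regroup = solve-∀

    module _ {x : Fin N} (column : Column x) (loadx : Load x) (weightx : Weight x) (square : Square x) where

      w′ : Fin N → ℕ
      w′ = weight (x ∷ ps)

      -- One term of the sum in `Weight` is at most the whole sum, and `w a` is `B` divided by the
      -- slack. A single condition on x thus serves all placed points at once.
      2d≤slack : ∀ {a} → a ∈ ps → 2 * d a x ≤ slack ps a
      2d≤slack {a} a∈ = *-cancelʳ-≤ _ _ (w a) ⦃ >-nonZero w>0 ⦄ (begin
        2 * d a x * w a                   ≡⟨ *-assoc 2 (d a x) (w a) ⟩
        2 * (d a x * w a)                 ≤⟨ *-monoʳ-≤ 2 (∑-∈ (λ a → d a x * w a) a∈) ⟩
        2 * ∑ ps (λ a → d a x * w a)      ≤⟨ weightx ⟩
        B                                 ≡⟨ slack*w a∈ ⟨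
        slack ps a * w a                  ∎)
        where
        w>0 : w a > 0
        w>0 = *-cancelˡ-< (slack ps a) 0 (w a)
          (subst₂ _<_ (sym (*-zeroʳ (slack ps a))) (sym (slack*w a∈)) B>0)

      d≤slack : ∀ {a} → a ∈ ps → d a x ≤ slack ps a
      d≤slack a∈ = ≤-trans (m≤m+n _ _) (2d≤slack a∈)

      -- Not crossing the old barrier s·k is precisely the invariant for k points.
      load′≤ : ∀ {a} → a ∈ x ∷ ps → load (x ∷ ps) a ≤ s * k
      load′≤ (here refl) = begin
        d x x + load ps x   ≡⟨ cong (_+ load ps x) (d-diag x) ⟩
        load ps x           ≤⟨ m≤m+n _ _ ⟩
        2 * load ps x       ≤⟨ loadx ⟩
        s * k               ∎
      load′≤ {a} (there a∈) = begin
        d a x + load ps a        ≤⟨ +-monoˡ-≤ (load ps a) (d≤slack a∈) ⟩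
        slack ps a + load ps a   ≡⟨ +-comm (slack ps a) _ ⟩
        load ps a + slack ps a   ≡⟨ load+slack a∈ ⟩
        s * k                    ∎

      load′+slack′ : ∀ {a} → a ∈ x ∷ ps → load (x ∷ ps) a + slack (x ∷ ps) a ≡ s * suc k
      load′+slack′ a∈ = m+[n∸m]≡n (≤-trans (load′≤ a∈) (*-monoʳ-≤ s (n≤1+n k)))

      slack′*w′ : ∀ {a} → a ∈ x ∷ ps → slack (x ∷ ps) a * w′ a ≡ B
      slack′*w′ {a} a∈ = T*q _
        (m<n⇒0<n∸m (≤-<-trans (load′≤ a∈) (*-monoʳ-< s ⦃ >-nonZero s>0 ⦄ (n<1+n k))))
        (≤-trans (m∸n≤m _ (load (x ∷ ps) a)) (*-monoʳ-≤ s (s≤s short)))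

      shift : ∀ {a} → a ∈ ps → slack (x ∷ ps) a + d a x ≡ slack ps a + s
      shift {a} a∈ = +-cancelʳ-≡ (load ps a) _ _ (begin-equality
        slack (x ∷ ps) a + d a x + load ps a     ≡⟨ regroup (slack (x ∷ ps) a) (d a x) (load ps a) ⟩
        d a x + load ps a + slack (x ∷ ps) a     ≡⟨ load′+slack′ (there a∈) ⟩
        s * suc k                                ≡⟨ *-suc s k ⟩
        s + s * k                                ≡⟨ cong (s +_) (load+slack a∈) ⟨
        s + (load ps a + slack ps a)             ≡⟨ regroup′ s (load ps a) (slack ps a) ⟩
        slack ps a + s + load ps a               ∎)
        where
        regroup : ∀ a b c → a + b + c ≡ b + c + a
        regroup = solve-∀
        regroup′ : ∀ a b c → a + (b + c) ≡ c + a + b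
        regroup′ = solve-∀

      W′ D c₁ c₂ c₃ c₄ : ℕ
      W′ = ∑ ps w′
      D  = ∑ ps (λ a → d a x * (w a * w a))
      c₁ = 4 * (s * k * suc k * B)
      c₂ = s * k * (s * k)
      c₃ = 4 * (s * k * k * B)
      c₄ = 8 * (s * k * k)

      summed : c₁ * W′ + c₂ * Q ≤ c₃ * W + c₄ * D + i * (B * B)
      summed = begin
        c₁ * W′ + c₂ * Q
          ≡⟨ cong₂ _+_ (∑-*ˡ ps c₁ w′) (∑-*ˡ ps c₂ _) ⟨
        ∑ ps (λ a → c₁ * w′ a) + ∑ ps (λ a → c₂ * (w a * w a))
          ≡⟨ ∑-+ ps _ _ ⟨
        ∑ ps (λ a → c₁ * w′ a + c₂ * (w a * w a))
          ≤⟨ ∑-mono ps (λ {a} a∈ → slack-step {T′ = slack (x ∷ ps) a} {d = d a x} s>0 (slack*w a∈) (slack′*w′ (there a∈)) (shift a∈)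
                                 (load+slack a∈) (2d≤slack a∈) (s≤slack a∈)) ⟩
        ∑ ps (λ a → c₃ * w a + c₄ * (d a x * (w a * w a)) + B * B)
          ≡⟨ ∑-+ ps _ _ ⟩
        ∑ ps (λ a → c₃ * w a + c₄ * (d a x * (w a * w a))) + ∑ ps (λ _ → B * B)
          ≡⟨ cong₂ _+_ (∑-+ ps _ _) (∑-const ps (B * B)) ⟩
        ∑ ps (λ a → c₃ * w a) + ∑ ps (λ a → c₄ * (d a x * (w a * w a))) + i * (B * B)
          ≡⟨ cong (_+ i * (B * B)) (cong₂ _+_ (∑-*ˡ ps c₃ w) (∑-*ˡ ps c₄ _)) ⟩
        c₃ * W + c₄ * D + i * (B * B) ∎

      -- The growth caused by x is paid for by the advance of the barrier: `Square` brings the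
      -- factor on the left to 64ℓ, which s exceeds.
      c₄D≤c₂Q : c₄ * D ≤ c₂ * Q
      c₄D≤c₂Q = begin
        c₄ * D                            ≤⟨ *-monoʳ-≤ c₄ square ⟩
        c₄ * (8 * ℓ * Q)                  ≡⟨ regroup s k ℓ Q ⟩
        64 * ℓ * (s * k * k * Q)          ≤⟨ *-monoˡ-≤ (s * k * k * Q) (*-monoˡ-≤ ℓ (m≤m+n 64 64)) ⟩
        128 * ℓ * (s * k * k * Q)         ≡⟨ cong (_* (s * k * k * Q)) s≡128ℓ ⟨
        s * (s * k * k * Q)               ≡⟨ regroup′ s k Q ⟩
        c₂ * Q                            ∎
        where
        regroup : ∀ s k ℓ Q → 8 * (s * k * k) * (8 * ℓ * Q) ≡ 64 * ℓ * (s * k * k * Q)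
        regroup = solve-∀
        regroup′ : ∀ s k Q → s * (s * k * k * Q) ≡ s * k * (s * k) * Q
        regroup′ = solve-∀

      -- Once the `Q` terms cancel in `summed`, division by `k * B` shows that the old points add at
      -- most B/4 to the scaled potential.
      old-weights : 4 * (s * suc k * W′) ≤ 4 * (s * k * W) + B
      old-weights = *-cancelˡ-≤ (k * B) ⦃ m*n≢0 k B ⦃ _ ⦄ ⦃ >-nonZero B>0 ⦄ ⦄ (+-cancelʳ-≤ (c₂ * Q) _ _ (begin
        k * B * (4 * (s * suc k * W′)) + c₂ * Q      ≡⟨ cong (_+ c₂ * Q) (regroup s k B W′) ⟩
        c₁ * W′ + c₂ * Q                             ≤⟨ summed ⟩
        c₃ * W + c₄ * D + i * (B * B)                ≤⟨ +-mono-≤ (+-monoʳ-≤ (c₃ * W) c₄D≤c₂Q) (*-monoˡ-≤ (B * B) (n≤1+n i)) ⟩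
        c₃ * W + c₂ * Q + k * (B * B)                ≡⟨ regroup′ s k B W (c₂ * Q) ⟩
        k * B * (4 * (s * k * W) + B) + c₂ * Q       ∎))
        where
        regroup : ∀ s k B W → k * B * (4 * (s * suc k * W)) ≡ 4 * (s * k * suc k * B) * W
        regroup = solve-∀
        regroup′ : ∀ s k B W c → 4 * (s * k * k * B) * W + c + k * (B * B) ≡ k * B * (4 * (s * k * W) + B) + c
        regroup′ = solve-∀

      -- By `Load`, the slack of x is at least half the height of the new barrier.
      new-weight : s * suc k * w′ x ≤ 2 * B
      new-weight = begin
        s * suc k * w′ x                    ≤⟨ *-monoˡ-≤ (w′ x) half ⟩
        2 * slack (x ∷ ps) x * w′ x         ≡⟨ *-assoc 2 (slack (x ∷ ps) x) (w′ x) ⟩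
        2 * (slack (x ∷ ps) x * w′ x)       ≡⟨ cong (2 *_) (slack′*w′ (here refl)) ⟩
        2 * B                               ∎
        where
        S = slack (x ∷ ps) x
        double : ∀ a b → 2 * (a + b) ≡ 2 * b + 2 * a
        double = solve-∀
        half : s * suc k ≤ 2 * S
        half = +-cancelʳ-≤ (s * suc k) _ _ (begin
          s * suc k + s * suc k               ≡⟨ cong (s * suc k +_) (+-identityʳ _) ⟨
          2 * (s * suc k)                     ≡⟨ cong (2 *_) (load′+slack′ (here refl)) ⟨
          2 * (d x x + load ps x + S)         ≡⟨ cong (λ z → 2 * (z + load ps x + S)) (d-diag x) ⟩
          2 * (load ps x + S)                 ≡⟨ double (load ps x) S ⟩
          2 * S + 2 * load ps x               ≤⟨ +-monoʳ-≤ (2 * S) (≤-trans loadx (*-monoʳ-≤ s (n≤1+n k))) ⟩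
          2 * S + s * suc k                   ∎)

      extended : Balanced (x ∷ ps)
      extended = record
        { load≤      = load′≤
        ; column≤    = λ { (here refl) → column ; (there c∈) → column≤ bal c∈ }
        -- The factor 4 avoids the fraction B/4. The increase is 2B + B/4, within the permitted 3B.
        ; potential≤ = *-cancelˡ-≤ 4 (begin
            4 * (s * suc k * (w′ x + W′))                    ≡⟨ split (s * suc k) (w′ x) W′ ⟩
            4 * (s * suc k * w′ x) + 4 * (s * suc k * W′)    ≤⟨ +-mono-≤ (*-monoʳ-≤ 4 new-weight) old-weights ⟩
            4 * (2 * B) + (4 * (s * k * W) + B)              ≤⟨ +-monoʳ-≤ (4 * (2 * B)) (+-monoˡ-≤ B (*-monoʳ-≤ 4 (potential≤ bal))) ⟩
            4 * (2 * B) + (4 * (3 * i * B) + B)              ≤⟨ m≤m+n _ (3 * B) ⟩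
            4 * (2 * B) + (4 * (3 * i * B) + B) + 3 * B      ≡⟨ collect i B ⟩
            4 * (3 * k * B)                                  ∎)
        }
        where
        split : ∀ a b c → 4 * (a * (b + c)) ≡ 4 * (a * b) + 4 * (a * c)
        split = solve-∀
        collect : ∀ i B → 4 * (2 * B) + (4 * (3 * i * B) + B) + 3 * B ≡ 4 * (3 * suc i * B)
        collect = solve-∀

    mostly-balanced : Mostly 4 (λ x → Balanced (x ∷ ps))
    mostly-balanced = mostly-map (λ { (c , l , w , q) → extended c l w q })
      (mostly-× mostly-column (mostly-× mostly-load (mostly-× mostly-weight mostly-square)))

-- Indicator functions.

δ : ∀ {n} → Fin n → Fin n → ℕ
δ a b = if does (a ≟ b) then 1 else 0

δ-refl : ∀ {n} (a : Fin n) → δ a a ≡ 1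
δ-refl a with a ≟ a
... | yes _  = refl
... | no a≢a = contradiction refl a≢a

δ-≢ : ∀ {n} {a b : Fin n} → a ≢ b → δ a b ≡ 0
δ-≢ {a = a} {b} a≢b with a ≟ b
... | yes a≡b = contradiction a≡b a≢b
... | no _    = refl

δ≡0⇒≢ : ∀ {n} {a b : Fin n} → δ a b ≡ 0 → a ≢ b
δ≡0⇒≢ {a = a} eq refl = contradiction (trans (sym (δ-refl a)) eq) λ ()

∑-δ≤1 : ∀ {n} {xs : List (Fin n)} (a : Fin n) → Unique xs → ∑ xs (δ a) ≤ 1
∑-δ≤1 a [] = z≤n
∑-δ≤1 {xs = x ∷ xs} a (x∉xs ∷ unique) with a ≟ x
... | no _     = ∑-δ≤1 a unique
... | yes refl = s≤s (begin
  ∑ xs (δ a)     ≤⟨ ∑-mono xs (λ b∈ → ≤-reflexive (δ-≢ (All.lookup x∉xs b∈))) ⟩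
  ∑ xs (λ _ → 0) ≡⟨ ∑-0 xs ⟩
  0              ∎)
  where open ≤-Reasoning

∑-lookup : ∀ {n} (p : Subset n) → ∑ (allFin n) (λ y → if lookup p y then 1 else 0) ≡ ∣ p ∣
∑-lookup []      = refl
∑-lookup {suc n} (b ∷ p) = trans (cong (bit b +_) tail) (head b)
  where
  bit : Bool → ℕ
  bit b = if b then 1 else 0
  tail : ∑ (tabulate suc) (λ y → bit (lookup (b ∷ p) y)) ≡ ∣ p ∣
  tail = trans (cong (λ ys → ∑ ys (λ y → bit (lookup (b ∷ p) y))) (sym (map-tabulate id suc)))
           (trans (∑-map suc (allFin n) _) (∑-lookup p))
  head : ∀ b → bit b + ∣ p ∣ ≡ ∣ b ∷ p ∣
  head true  = refl
  head false = refl

-- Incidences and codegrees of the map f.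

module Hit {N ℓ : ℕ} (f : PairMap N ℓ) where

  abstract

    -- Set to 0 for a = x, where the size of `fun f a x` is unconstrained; the bound ℓ then holds
    -- for all pairs.
    hit : Fin N → Fin N → Fin N → ℕ
    hit a x y = if does (a ≟ x) then 0 else (if lookup (fun f a x) y then 1 else 0)

    hit≡0⇒∉ : ∀ {a x y} → a ≢ x → hit a x y ≡ 0 → y ∉ fun f a x
    hit≡0⇒∉ {a} {x} {y} a≢x eq y∈ with a ≟ x
    ... | yes a≡x = a≢x a≡x
    ... | no _ rewrite []=⇒lookup y∈ = contradiction eq λ ()

    ∉⇒hit≡0 : ∀ {a x y} → (a ≢ x → y ∉ fun f a x) → hit a x y ≡ 0
    ∉⇒hit≡0 {a} {x} {y} y∉ with a ≟ x
    ... | yes _ = refl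
    ... | no a≢x with lookup (fun f a x) y in eq
    ...   | true  = contradiction (lookup⇒[]= y (fun f a x) eq) (y∉ a≢x)
    ...   | false = refl

    ∑-hit≤ℓ : ∀ a x → ∑ (allFin N) (hit a x) ≤ ℓ
    ∑-hit≤ℓ a x with a ≟ x
    ... | yes _  = ≤-trans (≤-reflexive (∑-0 (allFin N))) z≤n
    ... | no a≢x = ≤-reflexive (trans (∑-lookup (fun f a x)) (card f a x a≢x))

  hit-diag : ∀ a y → hit a a y ≡ 0
  hit-diag a y = ∉⇒hit≡0 (λ a≢a → contradiction refl a≢a)

  hit-selfˡ : ∀ a x → hit a x a ≡ 0
  hit-selfˡ a x = ∉⇒hit≡0 (avoidsˡ f a x)

  hit-selfʳ : ∀ a x → hit a x x ≡ 0
  hit-selfʳ a x = ∉⇒hit≡0 (avoidsʳ f a x)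

  hit-sym : ∀ a x y → hit a x y ≡ 0 → hit x a y ≡ 0
  hit-sym a x y eq = ∉⇒hit≡0 (λ x≢a → subst (y ∉_) (fun-sym f a x) (hit≡0⇒∉ (x≢a ∘ sym) eq))

  -- The d(a,y) of the barrier argument. It is not symmetric: every row sums to at most ℓN, a column
  -- only on average.
  codegree : Fin N → Fin N → ℕ
  codegree a y = ∑ (allFin N) (λ x → hit a x y)

  codegree-diag : ∀ a → codegree a a ≡ 0
  codegree-diag a = trans (∑-cong (allFin N) (hit-selfˡ a)) (∑-0 (allFin N))

  codegree-row : ∀ a → ∑ (allFin N) (codegree a) ≤ ℓ * N
  codegree-row a = begin
    ∑ (allFin N) (codegree a)                       ≡⟨ ∑-swap (allFin N) (allFin N) (λ y x → hit a x y) ⟩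
    ∑ (allFin N) (λ x → ∑ (allFin N) (hit a x))     ≤⟨ ∑-bound (allFin N) (λ {x} _ → ∑-hit≤ℓ a x) ⟩
    length (allFin N) * ℓ                           ≡⟨ cong (_* ℓ) (length-allFin N) ⟩
    N * ℓ                                           ≡⟨ *-comm N ℓ ⟩
    ℓ * N                                           ∎
    where open ≤-Reasoning

-- Degrees and adjacency by edge counting.

module Degree {n m : ℕ} (G : Graph n m) where

  open ≤-Reasoning

  e₁ e₂ : Fin m → Fin n
  e₁ e = proj₁ (edge G e)
  e₂ e = proj₂ (edge G e)

  deg : Fin n → ℕ
  deg v = ∑ (allFin m) (λ e → δ (e₁ e) v + δ (e₂ e) v)

  -- A number rather than a relation, so that it can weight the sum in `Unhitting`: it is positive
  -- on edges and sums to at most the degree.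
  adj : Fin n → Fin n → ℕ
  adj u v = ∑ (allFin m) (λ e → δ (e₁ e) u * δ (e₂ e) v + δ (e₂ e) u * δ (e₁ e) v)

  deg>0 : NoIsolated G → ∀ v → deg v > 0
  deg>0 covered v with covered v
  ... | e , inj₁ refl = ≤-trans (≤-trans (≤-reflexive (sym (δ-refl v))) (m≤m+n _ _)) (∑-∈ _ (∈-allFin e))
  ... | e , inj₂ refl = ≤-trans (≤-trans (≤-reflexive (sym (δ-refl v))) (m≤n+m _ _)) (∑-∈ _ (∈-allFin e))

  -- Each edge has two ends, and each end occurs at most once in `P`.
  ∑-deg≤2m : ∀ {P} → Unique P → ∑ P deg ≤ 2 * m
  ∑-deg≤2m {P} unique = begin
    ∑ P deg                                                         ≡⟨ ∑-swap P (allFin m) _ ⟩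
    ∑ (allFin m) (λ e → ∑ P (λ v → δ (e₁ e) v + δ (e₂ e) v))        ≤⟨ ∑-bound (allFin m) (λ {e} _ → both e) ⟩
    length (allFin m) * 2                                           ≡⟨ cong (_* 2) (length-allFin m) ⟩
    m * 2                                                           ≡⟨ *-comm m 2 ⟩
    2 * m                                                           ∎
    where
    both : ∀ e → ∑ P (λ v → δ (e₁ e) v + δ (e₂ e) v) ≤ 2
    both e = ≤-trans (≤-reflexive (∑-+ P _ _)) (+-mono-≤ (∑-δ≤1 (e₁ e) unique) (∑-δ≤1 (e₂ e) unique))

  ∑-adj≤deg : ∀ {P} v → Unique P → ∑ P (λ u → adj u v) ≤ deg v
  ∑-adj≤deg {P} v unique = begin
    ∑ P (λ u → adj u v)
      ≡⟨ ∑-swap P (allFin m) _ ⟩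
    ∑ (allFin m) (λ e → ∑ P (λ u → δ (e₁ e) u * δ (e₂ e) v + δ (e₂ e) u * δ (e₁ e) v))
      ≤⟨ ∑-mono (allFin m) (λ {e} _ → both e) ⟩
    deg v ∎
    where
    at-most : ∀ a c → ∑ P (λ u → δ a u * c) ≤ c
    at-most a c = begin
      ∑ P (λ u → δ a u * c)   ≡⟨ ∑-*ʳ P c (δ a) ⟩
      ∑ P (δ a) * c           ≤⟨ *-monoˡ-≤ c (∑-δ≤1 a unique) ⟩
      1 * c                   ≡⟨ *-identityˡ c ⟩
      c                       ∎
    both : ∀ e → ∑ P (λ u → δ (e₁ e) u * δ (e₂ e) v + δ (e₂ e) u * δ (e₁ e) v)
               ≤ δ (e₁ e) v + δ (e₂ e) v
    both e = begin
      ∑ P (λ u → δ (e₁ e) u * δ (e₂ e) v + δ (e₂ e) u * δ (e₁ e) v)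
        ≡⟨ ∑-+ P _ _ ⟩
      ∑ P (λ u → δ (e₁ e) u * δ (e₂ e) v) + ∑ P (λ u → δ (e₂ e) u * δ (e₁ e) v)
        ≤⟨ +-mono-≤ (at-most (e₁ e) _) (at-most (e₂ e) _) ⟩
      δ (e₂ e) v + δ (e₁ e) v
        ≡⟨ +-comm (δ (e₂ e) v) _ ⟩
      δ (e₁ e) v + δ (e₂ e) v ∎

  adj₁ : ∀ e → adj (e₁ e) (e₂ e) > 0
  adj₁ e = ≤-trans (≤-trans (≤-reflexive (sym (cong₂ _*_ (δ-refl (e₁ e)) (δ-refl (e₂ e))))) (m≤m+n _ _)) (∑-∈ _ (∈-allFin e))

  adj₂ : ∀ e → adj (e₂ e) (e₁ e) > 0
  adj₂ e = ≤-trans (≤-trans (≤-reflexive (sym (cong₂ _*_ (δ-refl (e₂ e)) (δ-refl (e₁ e))))) (m≤n+m _ _)) (∑-∈ _ (∈-allFin e))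

-- The greedy embedding.

module Embedding
  {n m N ℓ : ℕ} (G : Graph n m) (covered : NoIsolated G) (f : PairMap N ℓ)
  (m>0 : m > 0) (ℓ>0 : ℓ > 0) (s : ℕ) (s≡128ℓ : s ≡ 128 * ℓ) (16sm≤N : 16 * (s * m) ≤ N)
  (B : ℕ) (q : ℕ → ℕ) (B>0 : B > 0)
  (T*q : ∀ T → T > 0 → T ≤ s * suc (2 * m) → T * q T ≡ B)
  where

  open ≤-Reasoning
  open Hit f
  open Degree G
  open Balance N ℓ s (2 * m) B q ℓ>0 s≡128ℓ B>0 T*q codegree codegree-row codegree-diag

  N>0 : N > 0
  N>0 = <-≤-trans (*-mono-< {0} {16} (s≤s z≤n) (*-mono-< s>0 m>0)) 16sm≤N

  -- `φ` is total, but only its values on the placed vertices `P` are constrained.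
  record Embeds (φ : Fin n → Fin N) (P : List (Fin n)) : Set where
    field
      injective : ∀ {u v} → u ∈ P → v ∈ P → φ u ≡ φ v → u ≡ v
      free      : ∀ e {w} → e₁ e ∈ P → e₂ e ∈ P → w ∈ P → hit (φ (e₁ e)) (φ (e₂ e)) (φ w) ≡ 0
      balanced  : Balanced (map φ P)

  open Embeds

  module Place {φ : Fin n → Fin N} {P : List (Fin n)} (emb : Embeds φ P) {v : Fin n}
    (v∉P : All (v ≢_) P) (unique : Unique P) (deg-min : All (λ u → deg v ≤ deg u) P) where

    i : ℕ
    i = length P

    -- Without isolated vertices, each vertex contributes at least 1 to the degree sum.
    i<2m : i < 2 * m
    i<2m = begin
      suc i                      ≡⟨ *-identityʳ (suc i) ⟨
      suc i * 1                  ≡⟨ ∑-const (v ∷ P) 1 ⟨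
      ∑ (v ∷ P) (λ _ → 1)        ≤⟨ ∑-mono (v ∷ P) (λ {u} _ → deg>0 covered u) ⟩
      ∑ (v ∷ P) deg              ≤⟨ ∑-deg≤2m (v∉P ∷ unique) ⟩
      2 * m                      ∎

    -- Here the order of placement enters: every placed vertex has degree at least `deg v`.
    i*deg≤2m : i * deg v ≤ 2 * m
    i*deg≤2m = begin
      i * deg v                  ≡⟨ ∑-const P (deg v) ⟨
      ∑ P (λ _ → deg v)          ≤⟨ ∑-mono P (All.lookup deg-min) ⟩
      ∑ P deg                    ≤⟨ ∑-deg≤2m unique ⟩
      2 * m                      ∎

    -- `Fresh` serves injectivity, `Unhit` keeps x out of the sets of old edges, and `Unhitting`
    -- keeps placed points out of the sets of new edges. `Unhit` ranges over all edges, also those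
    -- with an end not yet placed; this still forbids at most ℓm points.
    Fresh Unhit Unhitting : Fin N → Set
    Fresh x     = ∑ P (λ w → δ (φ w) x) ≡ 0
    Unhit x     = ∑ (allFin m) (λ e → hit (φ (e₁ e)) (φ (e₂ e)) x) ≡ 0
    Unhitting x = ∑ P (λ u → adj u v * ∑ P (λ w → hit (φ u) x (φ w))) ≡ 0

    ℓ≤s : ℓ ≤ s
    ℓ≤s = subst (ℓ ≤_) (sym s≡128ℓ) (m≤m+n ℓ (127 * ℓ))

    mostly-fresh : Mostly 1 Fresh
    mostly-fresh = mostly-zero _ (begin
      8 * ∑ (allFin N) (λ x → ∑ P (λ w → δ (φ w) x))   ≡⟨ cong (8 *_) (∑-swap (allFin N) P _) ⟩
      8 * ∑ P (λ w → ∑ (allFin N) (δ (φ w)))           ≤⟨ *-monoʳ-≤ 8 (∑-bound P (λ {w} _ → ∑-δ≤1 (φ w) (allFin⁺ N))) ⟩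
      8 * (i * 1)                                      ≤⟨ *-monoʳ-≤ 8 (*-mono-≤ (<⇒≤ i<2m) s>0) ⟩
      8 * (2 * m * s)                                  ≡⟨ regroup m s ⟩
      16 * (s * m)                                     ≤⟨ 16sm≤N ⟩
      N                                                ∎)
      where
      regroup : ∀ m s → 8 * (2 * m * s) ≡ 16 * (s * m)
      regroup = solve-∀

    mostly-unhit : Mostly 1 Unhit
    mostly-unhit = mostly-zero _ (begin
      8 * ∑ (allFin N) (λ x → ∑ (allFin m) (λ e → hit (φ (e₁ e)) (φ (e₂ e)) x))
        ≡⟨ cong (8 *_) (∑-swap (allFin N) (allFin m) _) ⟩
      8 * ∑ (allFin m) (λ e → ∑ (allFin N) (hit (φ (e₁ e)) (φ (e₂ e))))
        ≤⟨ *-monoʳ-≤ 8 (∑-bound (allFin m) (λ {e} _ → ∑-hit≤ℓ (φ (e₁ e)) (φ (e₂ e)))) ⟩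
      8 * (length (allFin m) * ℓ)
        ≡⟨ cong (λ z → 8 * (z * ℓ)) (length-allFin m) ⟩
      8 * (m * ℓ)
        ≤⟨ *-mono-≤ (m≤m+n 8 8) (≤-trans (*-monoʳ-≤ m ℓ≤s) (≤-reflexive (*-comm m s))) ⟩
      16 * (s * m)
        ≤⟨ 16sm≤N ⟩
      N ∎)

    codegree-sum≤ : ∀ {u} → u ∈ P → ∑ P (λ w → codegree (φ u) (φ w)) ≤ s * i
    codegree-sum≤ {u} u∈ = begin
      ∑ P (λ w → codegree (φ u) (φ w))   ≡⟨ ∑-map φ P (codegree (φ u)) ⟨
      load (map φ P) (φ u)               ≤⟨ load≤ (balanced emb) (∈-map⁺ φ u∈) ⟩
      s * length (map φ P)               ≡⟨ cong (s *_) (length-map φ P) ⟩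
      s * i                              ∎

    -- Exchanging the sums produces the load of each placed neighbour, at most s·i. With the
    -- neighbours counted by `deg v`, the total is at most s·i·deg v ≤ 2sm, whence the 16 = 8 · 2 in
    -- the bound on N.
    mostly-unhitting : Mostly 1 Unhitting
    mostly-unhitting = mostly-zero _ (begin
      8 * ∑ (allFin N) (λ x → ∑ P (λ u → adj u v * ∑ P (λ w → hit (φ u) x (φ w))))
        ≡⟨ cong (8 *_) (∑-swap (allFin N) P _) ⟩
      8 * ∑ P (λ u → ∑ (allFin N) (λ x → adj u v * ∑ P (λ w → hit (φ u) x (φ w))))
        ≡⟨ cong (8 *_) (∑-cong P (λ u → trans (∑-*ˡ (allFin N) (adj u v) _)
                                           (cong (adj u v *_) (∑-swap (allFin N) P _)))) ⟩
      8 * ∑ P (λ u → adj u v * ∑ P (λ w → codegree (φ u) (φ w)))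
        ≤⟨ *-monoʳ-≤ 8 (∑-mono P (λ {u} u∈ → *-monoʳ-≤ (adj u v) (codegree-sum≤ u∈))) ⟩
      8 * ∑ P (λ u → adj u v * (s * i))
        ≡⟨ cong (8 *_) (∑-*ʳ P (s * i) _) ⟩
      8 * (∑ P (λ u → adj u v) * (s * i))
        ≤⟨ *-monoʳ-≤ 8 (*-monoˡ-≤ (s * i) (∑-adj≤deg v unique)) ⟩
      8 * (deg v * (s * i))
        ≡⟨ regroup (deg v) s i ⟩
      8 * (s * (i * deg v))
        ≤⟨ *-monoʳ-≤ 8 (*-monoʳ-≤ s i*deg≤2m) ⟩
      8 * (s * (2 * m))
        ≡⟨ regroup′ s m ⟩
      16 * (s * m)
        ≤⟨ 16sm≤N ⟩
      N ∎)
      where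
      regroup : ∀ a s i → 8 * (a * (s * i)) ≡ 8 * (s * (i * a))
      regroup = solve-∀
      regroup′ : ∀ s m → 8 * (s * (2 * m)) ≡ 16 * (s * m)
      regroup′ = solve-∀

    module _ {x : Fin N} (fresh : Fresh x) (unhit : Unhit x) (unhitting : Unhitting x)
      (bal : Balanced (x ∷ map φ P)) where

      φ′ : Fin n → Fin N
      φ′ = updateAt φ v (λ _ → x)

      φ′-new : φ′ v ≡ x
      φ′-new = updateAt-updates v φ

      φ′-old : ∀ {u} → u ∈ P → φ′ u ≡ φ u
      φ′-old u∈ = updateAt-minimal _ v φ (All.lookup v∉P u∈ ∘ sym)

      φ≢x : ∀ {u} → u ∈ P → φ u ≢ x
      φ≢x u∈ = δ≡0⇒≢ (∑≡0⇒≡0 (λ w → δ (φ w) x) fresh u∈)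

      hit-new : ∀ {u w} → adj u v > 0 → u ∈ P → w ∈ P → hit (φ u) x (φ w) ≡ 0
      hit-new {u} adjacent u∈ w∈ with m*n≡0⇒m≡0∨n≡0 (adj u v) (∑≡0⇒≡0 _ unhitting u∈)
      ... | inj₁ adj≡0 = contradiction (subst (_> 0) adj≡0 adjacent) λ ()
      ... | inj₂ sum≡0 = ∑≡0⇒≡0 _ sum≡0 w∈

      injective′ : ∀ {u w} → u ∈ v ∷ P → w ∈ v ∷ P → φ′ u ≡ φ′ w → u ≡ w
      injective′ (here refl) (here refl) _  = refl
      injective′ (here refl) (there w∈)  eq =
        contradiction (trans (sym (φ′-old w∈)) (trans (sym eq) φ′-new)) (φ≢x w∈)
      injective′ (there u∈)  (here refl) eq =
        contradiction (trans (sym (φ′-old u∈)) (trans eq φ′-new)) (φ≢x u∈)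
      injective′ (there u∈)  (there w∈)  eq =
        injective emb u∈ w∈ (trans (sym (φ′-old u∈)) (trans eq (φ′-old w∈)))

      -- If both ends equal v, the diagonal convention of `hit` applies; if w = v is one end, f
      -- avoids its own pair. `Unhitting` settles a new edge with w old, and `Unhit` an old edge
      -- with w = v.
      free′ : ∀ e {w} → e₁ e ∈ v ∷ P → e₂ e ∈ v ∷ P → w ∈ v ∷ P →
              hit (φ′ (e₁ e)) (φ′ (e₂ e)) (φ′ w) ≡ 0
      free′ e (here eq₁) (here eq₂) _ rewrite eq₁ | eq₂ = hit-diag (φ′ v) _
      free′ e (here eq₁) (there e₂∈) (here refl) rewrite eq₁ = hit-selfˡ (φ′ v) _
      free′ e (there e₁∈) (here eq₂) (here refl) rewrite eq₂ = hit-selfʳ _ (φ′ v)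
      free′ e (here eq₁) (there e₂∈) (there w∈)
        rewrite cong φ′ eq₁ | φ′-new | φ′-old e₂∈ | φ′-old w∈ =
        hit-sym (φ (e₂ e)) x _ (hit-new (subst (λ u → adj (e₂ e) u > 0) eq₁ (adj₂ e)) e₂∈ w∈)
      free′ e (there e₁∈) (here eq₂) (there w∈)
        rewrite cong φ′ eq₂ | φ′-new | φ′-old e₁∈ | φ′-old w∈ =
        hit-new (subst (λ u → adj (e₁ e) u > 0) eq₂ (adj₁ e)) e₁∈ w∈
      free′ e (there e₁∈) (there e₂∈) (here refl)
        rewrite φ′-new | φ′-old e₁∈ | φ′-old e₂∈ = ∑≡0⇒≡0 _ unhit (∈-allFin e)
      free′ e (there e₁∈) (there e₂∈) (there w∈)
        rewrite φ′-old e₁∈ | φ′-old e₂∈ | φ′-old w∈ = free emb e e₁∈ e₂∈ w∈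

      placed : Embeds φ′ (v ∷ P)
      placed = record
        { injective = injective′
        ; free      = free′
        ; balanced  = subst Balanced (sym (cong₂ _∷_ φ′-new (map-cong-local (All.tabulate φ′-old)))) bal
        }

    mostly-good : Mostly 7 (λ x → Fresh x × Unhit x × Unhitting x × Balanced (x ∷ map φ P))
    mostly-good = mostly-× mostly-fresh (mostly-× mostly-unhit (mostly-× mostly-unhitting
      (Extend.mostly-balanced (balanced emb) (subst (_< 2 * m) (sym (length-map φ P)) i<2m))))

    place : ∃ λ φ′ → Embeds φ′ (v ∷ P)
    place =
      let x , fresh , unhit , unhitting , bal = mostly⇒∃ N>0 mostly-good
      in φ′ fresh unhit unhitting bal , placed fresh unhit unhitting bal

  -- The list increases in degree and the recursion places its tail first, so the vertices are
  -- placed in order of decreasing degree.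
  embed : ∀ {P} → Unique P → AllPairs (λ v u → deg v ≤ deg u) P → ∃ λ φ → Embeds φ P
  embed [] [] = (λ _ → fromℕ< N>0) , record
    { injective = λ ()
    ; free      = λ _ ()
    ; balanced  = balanced-[]
    }
  embed (v∉P ∷ unique) (deg-min ∷ sorted) =
    Place.place (proj₂ (embed unique sorted)) v∉P unique deg-min

  byDegree : DecTotalOrder 0ℓ 0ℓ 0ℓ
  byDegree = On.decTotalOrder ≤-decTotalOrder deg

  open Data.List.Sort byDegree using (sort; sort-↭; sort-↗)

  good-embedding : ∃ (Good G f)
  good-embedding with embed unique sorted
    where
    unique : Unique (sort (allFin n))
    unique = Unique-resp-↭ (setoid (Fin n)) (↭⇒↭ₛ (↭-sym (sort-↭ (allFin n)))) (allFin⁺ n)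
    sorted : AllPairs (λ v u → deg v ≤ deg u) (sort (allFin n))
    sorted = Sorted⇒AllPairs (DecTotalOrder.totalOrder byDegree) (sort-↗ (allFin n))
  ... | φ , emb = φ , (λ {u} {v} → injective emb (all u) (all v)) ,
    -- A vanishing `hit` is informative only off the diagonal: the ends of e have distinct images
    -- because e is no loop and `φ` is injective.
    λ e w → hit≡0⇒∉ (loopless G e ∘ injective emb (all (e₁ e)) (all (e₂ e)))
                    (free emb e (all (e₁ e)) (all (e₂ e)) (all w))
    where
    all : ∀ v → v ∈ sort (allFin n)
    all v = ∈-resp-↭ (↭-sym (sort-↭ (allFin n))) (∈-allFin v)

theorem2p1 : Σ ℕ λ C → C > 0 ×
    (∀ (m ℓ : ℕ) → m > 0 → ℓ > 0 → ∀ (N : ℕ) → C * ℓ * m ≤ N →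
    ∀ (n : ℕ) (G : Graph n m) → NoIsolated G → (f : PairMap N ℓ) →
    Σ (Fin n → Fin N) λ φ → Good G f φ)
-- 2048 = 16 · 128, from 16sm ≤ N with s = 128ℓ. There are at most 2m vertices, so reciprocals up to
-- s(2m+1) suffice.
theorem2p1 = 2048 , s≤s z≤n , λ m ℓ m>0 ℓ>0 N large n G covered f →
  let B , q , B>0 , T*q = reciprocals (128 * ℓ * suc (2 * m))
  in Embedding.good-embedding G covered f m>0 ℓ>0 (128 * ℓ) refl
       (≤-trans (≤-reflexive (regroup ℓ m)) large) B q B>0 T*q
  where
  regroup : ∀ ℓ m → 16 * (128 * ℓ * m) ≡ 2048 * ℓ * m
  regroup ℓ m = trans (sym (*-assoc 16 (128 * ℓ) m)) (cong (_* m) (sym (*-assoc 16 128 ℓ)))
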